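{- Let $A$ be a subset of $(\mathbb{Z}/3\mathbb{Z})^n$ containing no three-term arithmetic progression. Then $|A| = o(2.756^n)$ as $n \to \infty$. That is, if $r_3((\mathbb{Z}/3\mathbb{Z})^n)$ denotes the maximal size of a subset of $(\mathbb{Z}/3\mathbb{Z})^n$ containing no three-term arithmetic progression, then $$\lim_{n\to\infty} \frac{r_3((\mathbb{Z}/3\mathbb{Z})^n)}{2.756^n} = 0.$$
   Context: A three-term arithmetic progression in an abelian group $G$ means a nontrivial one: elements $a,\ a+h,\ a+2h$ of $G$ with $h \neq 0$. The constant $2.756$ is the exact decimal $2756/1000$. -}

module Defs where

open import Algebra.Bundles using (AbelianGroup)
open import Data.Fin.Base as Fin using (Fin; zero; suc; toℕ; finToFun; funToFin)
open import Data.Fin.Properties as Fin using (any?; all?; injective⇒≤; finToFun-funToFin)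
open import Data.Integer.Base using (+_)
open import Data.List.Base using (List; []; length; lookup; tabulate)
open import Data.List.Properties using (length-tabulate; tabulate-lookup)
open import Data.List.Relation.Unary.All as All using ([]; _∷_)
open import Data.List.Relation.Unary.AllPairs using ([]; _∷_)
open import Data.Nat.Base as ℕ using (ℕ; zero; suc)
open import Data.Nat.DivMod using (_mod_)
open import Data.Nat.Properties as ℕ using ()
open import Data.Product.Base using (∃₂; ∃-syntax; _×_; _,_; proj₁; proj₂)
open import Data.Rational.Base hiding (_⊔_)
open import Data.Rational.Properties as ℚ using ()
open import Function.Base using (_∘_)
open import Level using (Level; _⊔_; 0ℓ)
open import Relation.Binary.Bundles using (DecSetoid)
open import Relation.Binary.Definitions using (Decidable; _Respects_)
open import Relation.Binary.PropositionalEquality as ≡ using (_≡_; refl)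
open import Relation.Nullary using (¬_; Dec; yes; no; contradiction)
open import Relation.Nullary.Decidable using (¬?; _×-dec_; map′; from-yes)
import Algebra.Construct.Pointwise as Pointwise
import Algebra.Definitions.RawSemiring as RawSemiring
import Data.List.Membership.Setoid as Membership
import Data.List.Membership.Setoid.Properties as MembershipProperties
open import Data.List.Membership.Propositional.Properties using (∈-lookup)
import Data.List.Membership.DecSetoid as DecMembership
import Data.List.Relation.Binary.Equality.Setoid as ListEquality
import Data.List.Relation.Unary.Unique.Setoid as UniqueSetoid
import Data.List.Relation.Unary.Unique.DecSetoid as UniqueDecSetoid

private variable
  c ℓ : Level

module _ (G : AbelianGroup c ℓ) where
  open AbelianGroup G
  open Membership setoid using (_∈_)
  open UniqueSetoid setoid using (Unique)

  ContainsThreeTermAP : List Carrier → Set (c ⊔ ℓ)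
  ContainsThreeTermAP A =
    ∃₂ λ a h → ¬ h ≈ ε × a ∈ A × (a ∙ h) ∈ A × (a ∙ (h ∙ h)) ∈ A

  -- Finite subsets of G are duplicate-free lists, so `length` is cardinality.
  IsAPFreeSet : List Carrier → Set (c ⊔ ℓ)
  IsAPFreeSet A = Unique A × ¬ ContainsThreeTermAP A

  IsMaxAPFreeSize : ℕ → Set (c ⊔ ℓ)
  IsMaxAPFreeSize m =
    (∃[ A ] IsAPFreeSet A × length A ≡ m) ×
    (∀ A → IsAPFreeSet A → length A ℕ.≤ m)

private
  greatest : {P : ℕ → Set ℓ} → (∀ m → Dec (P m)) → P 0 →
             ∀ N → (∀ m → P m → m ℕ.≤ N) →
             ∃[ m ] P m × (∀ k → P k → k ℕ.≤ m)
  greatest P? P0 zero    bound = 0 , P0 , bound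
  greatest P? P0 (suc N) bound with P? (suc N)
  ... | yes p = suc N , p , bound
  ... | no ¬p = greatest P? P0 N λ m pm →
    ℕ.s≤s⁻¹ (ℕ.≤∧≢⇒< (bound m pm) λ { refl → ¬p pm })

-- A finite abelian group, listed (possibly with repetitions) by `enum`, has an
-- AP-free subset of maximal size.
module _
  (G : AbelianGroup c ℓ)
  (_≟_ : Decidable (AbelianGroup._≈_ G))
  {N : ℕ} (enum : Fin N → AbelianGroup.Carrier G) (index : AbelianGroup.Carrier G → Fin N)
  (enum-index : ∀ x → AbelianGroup._≈_ G (enum (index x)) x)
  where
  open AbelianGroup G hiding (refl)

  private
    decSetoid : DecSetoid c ℓ
    decSetoid = record { isDecEquivalence =
      record { isEquivalence = isEquivalence ; _≟_ = _≟_ } }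

    open Membership setoid using (_∈_)
    open DecMembership decSetoid using (_∈?_)
    open UniqueSetoid setoid using (Unique)
    open UniqueDecSetoid decSetoid using (unique?)
    open ListEquality setoid using (_≋_; ≋-sym; ≋-reflexive; ≋-trans; tabulate⁺; Unique-resp-≋)

    containsAP? : ∀ A → Dec (ContainsThreeTermAP G A)
    containsAP? A = map′
      (λ { (i , j , p) → enum i , enum j , p })
      (λ { (a , h , h≉ε , a∈ , ah∈ , ahh∈) →
        let a≈ = sym (enum-index a)
            h≈ = sym (enum-index h)
        in index a , index h
         , (λ e → h≉ε (trans h≈ e))
         , resp a≈ a∈
         , resp (∙-cong a≈ h≈) ah∈
         , resp (∙-cong a≈ (∙-cong h≈ h≈)) ahh∈ })
      (any? λ i → any? λ j →
        ¬? (enum j ≟ ε) ×-dec enum i ∈? A ×-dec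
        (enum i ∙ enum j) ∈? A ×-dec (enum i ∙ (enum j ∙ enum j)) ∈? A)
      where
      resp : ∀ {x y} → x ≈ y → x ∈ A → y ∈ A
      resp = MembershipProperties.∈-resp-≈ setoid

    isAPFreeSet? : ∀ A → Dec (IsAPFreeSet G A)
    isAPFreeSet? A = unique? A ×-dec ¬? (containsAP? A)

    isAPFreeSet-resp-≋ : IsAPFreeSet G Respects _≋_
    isAPFreeSet-resp-≋ A≋B (u , free) =
      Unique-resp-≋ A≋B u ,
      λ { (a , h , h≉ε , a∈ , ah∈ , ahh∈) →
          free (a , h , h≉ε , back a∈ , back ah∈ , back ahh∈) }
      where
      back : ∀ {x} → x ∈ _ → x ∈ _
      back = MembershipProperties.∈-resp-≋ setoid (≋-sym A≋B)

    HasAPFreeSet : ℕ → Set (c ⊔ ℓ)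
    HasAPFreeSet m = ∃[ A ] IsAPFreeSet G A × length A ≡ m

    listed : ∀ m → Fin (N ℕ.^ m) → List Carrier
    listed m k = tabulate {n = m} (enum ∘ finToFun k)

    listed-complete : ∀ A → A ≋ listed (length A) (funToFin (index ∘ lookup A))
    listed-complete A = ≋-trans
      (≋-reflexive (≡.sym (tabulate-lookup A)))
      (tabulate⁺ λ i → trans (sym (enum-index (lookup A i)))
        (reflexive (≡.cong enum
          (≡.sym (finToFun-funToFin (index ∘ lookup A) i)))))

    hasAPFreeSet? : ∀ m → Dec (HasAPFreeSet m)
    hasAPFreeSet? m = map′
      (λ { (k , free) → listed m k , free , length-tabulate _ })
      (λ { (A , free , refl) →
        funToFin (index ∘ lookup A) , isAPFreeSet-resp-≋ (listed-complete A) free })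
      (any? λ k → isAPFreeSet? (listed m k))

    lookup-injective : ∀ {A} → Unique A → ∀ {i j} → lookup A i ≈ lookup A j → i ≡ j
    lookup-injective (_ ∷ _)  {zero}  {zero}  _ = refl
    lookup-injective (x≉ ∷ _) {zero}  {suc j} e = contradiction e (All.lookup x≉ (∈-lookup j))
    lookup-injective (x≉ ∷ _) {suc i} {zero}  e = contradiction (sym e) (All.lookup x≉ (∈-lookup i))
    lookup-injective (_ ∷ u)  {suc _} {suc _} e = ≡.cong suc (lookup-injective u e)

    index-injective : ∀ {x y} → index x ≡ index y → x ≈ y
    index-injective {x} {y} e =
      trans (sym (enum-index x)) (trans (reflexive (≡.cong enum e)) (enum-index y))

    empty-isAPFreeSet : IsAPFreeSet G []
    empty-isAPFreeSet = [] , λ { (_ , _ , _ , () , _) }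

    bound : ∀ m → HasAPFreeSet m → m ℕ.≤ N
    bound _ (A , (u , _) , refl) =
      injective⇒≤ {f = index ∘ lookup A} (lookup-injective u ∘ index-injective)

  maxAPFreeSize : ∃[ m ] IsMaxAPFreeSize G m
  maxAPFreeSize with greatest hasAPFreeSet? ([] , empty-isAPFreeSet , refl) N bound
  ... | m , attained , maximal =
    m , attained , λ A free → maximal (length A) (A , free , refl)

ℤ/3 : AbelianGroup 0ℓ 0ℓ
ℤ/3 = record
  { Carrier = Fin 3
  ; _≈_ = _≡_
  ; _∙_ = _+₃_
  ; ε   = zero
  ; _⁻¹ = -₃_
  ; isAbelianGroup = record
    { isGroup = record
      { isMonoid = record
        { isSemigroup = record
          { isMagma = record { isEquivalence = ≡.isEquivalence ; ∙-cong = ≡.cong₂ _+₃_ }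
          ; assoc = from-yes (all? λ i → all? λ j → all? λ k →
              ((i +₃ j) +₃ k) Fin.≟ (i +₃ (j +₃ k)))
          }
        ; identity = from-yes (all? λ i → (zero +₃ i) Fin.≟ i)
                   , from-yes (all? λ i → (i +₃ zero) Fin.≟ i)
        }
      ; inverse = from-yes (all? λ i → ((-₃ i) +₃ i) Fin.≟ zero)
                , from-yes (all? λ i → (i +₃ (-₃ i)) Fin.≟ zero)
      ; ⁻¹-cong = ≡.cong -₃_
      }
    ; comm = from-yes (all? λ i → all? λ j → (i +₃ j) Fin.≟ (j +₃ i))
    }
  }
  where
  _+₃_ : Fin 3 → Fin 3 → Fin 3
  i +₃ j = (toℕ i ℕ.+ toℕ j) mod 3

  -₃_ : Fin 3 → Fin 3
  -₃ i = (3 ℕ.∸ toℕ i) mod 3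

[ℤ/3]^_ : ℕ → AbelianGroup 0ℓ 0ℓ
[ℤ/3]^ n = Pointwise.abelianGroup (Fin n) ℤ/3

private
  r₃-exists : ∀ n → ∃[ m ] IsMaxAPFreeSize ([ℤ/3]^ n) m
  r₃-exists n = maxAPFreeSize ([ℤ/3]^ n)
    (λ f g → all? λ i → f i Fin.≟ g i) finToFun funToFin finToFun-funToFin

r₃[ℤ/3]^_ : ℕ → ℕ
r₃[ℤ/3]^ n = proj₁ (r₃-exists n)

r₃-isMaxAPFreeSize : ∀ n → IsMaxAPFreeSize ([ℤ/3]^ n) (r₃[ℤ/3]^ n)
r₃-isMaxAPFreeSize n = proj₂ (r₃-exists n)

open RawSemiring +-*-rawSemiring public using (_^_)

2·756 : ℚ
2·756 = + 2756 / 1000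

2·756^n-positive : ∀ n → Positive (2·756 ^ n)
2·756^n-positive zero    = _
2·756^n-positive (suc n) =
  ℚ.pos*pos⇒pos 2·756 (2·756 ^ n) {{2·756^n-positive n}}

2·756^n-nonZero : ∀ n → NonZero (2·756 ^ n)
2·756^n-nonZero n = ℚ.pos⇒nonZero (2·756 ^ n) {{2·756^n-positive n}}

infix 4 _⟶_

-- Every positive real has a positive rational below it, so for rational
-- sequences this is convergence in ℝ.
_⟶_ : (ℕ → ℚ) → ℚ → Set
u ⟶ l = ∀ ε → 0ℚ < ε → ∃[ N ] ∀ n → N ℕ.≤ n → ∣ u n - l ∣ < ε

{-# OPTIONS --safe #-}

-- Tao's symmetric form of the Croot–Lev–Pach–Ellenberg–Gijswijt argument.  For a
-- progression-free A ⊆ F₃ⁿ the polynomial F(x,y,z) = ∏ᵢ (1 - (xᵢ + yᵢ + zᵢ)²) is the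
-- indicator of x = y = z on A³.  It has degree 2n, so in each of its monomials
-- x^α y^β z^γ one of the exponents is low, i.e. has degree at most 2n/3.  Let N be
-- the number of low exponents in {0,1,2}ⁿ, and suppose |A| > 2N.  Call a function on A
-- an annihilator if it is orthogonal to the low monomials.  If h is one, then N linear
-- equations make d : A → F₃ an annihilator too, and N more kill the coefficients of the
-- low x^α in ∑ F(x,y,z) d(y) h(z) = d(x) h(x); the other coefficients then vanish
-- because y^β or z^γ is low.  So some d ≠ 0 satisfies d h = 0, and h + d is an
-- annihilator with larger support than h.  Iterating from h = 0 is absurd, so |A| ≤ 2N.
--
-- Weighting α by t^|α| with t = (5/6)³ gives N ≤ (89281/32400)ⁿ, and
-- 89281/32400 < 2.756.
module Submission where

open import Defs hiding (_^_)
open import Data.Rational.Base using (_/_; _÷_; 0ℚ)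

open import Algebra.Bundles using (AbelianGroup; CommutativeMonoid; CommutativeRing; Semiring)
import Algebra.Definitions.RawSemiring as RawSemiring
import Algebra.Properties.AbelianGroup as AbelianGroupProperties
import Algebra.Properties.CommutativeMonoid.Sum as CommutativeMonoidSum
import Algebra.Properties.CommutativeSemigroup as CommutativeSemigroupProperties
import Algebra.Properties.Semiring.Sum as SemiringSum
open import Algebra.Structures using (IsCommutativeRing)
open import Data.Fin.Base using (Fin; zero; suc; toℕ; finToFun; funToFin; combine; punchIn)
open import Data.Fin.Properties as Fin
  using (all?; ¬∀⟶∃¬; pigeonhole; finToFun-funToFin; funToFin-finToFin; punchInᵢ≢i)
open import Data.Fin.Subset using (Subset; _∈_; _⊂_)
open import Data.Fin.Subset.Induction using (⊂-wellFounded)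
open import Data.Integer.Base as ℤ using (+[1+_])
import Data.Integer.Properties as ℤ
open import Data.List.Base as List using (List; []; _∷_; length; filter; cartesianProductWith; allFin)
open import Data.List.Membership.Propositional using () renaming (_∈_ to _∈ˡ_)
open import Data.List.Membership.Propositional.Properties
  using (∈-cartesianProductWith⁺; ∈-filter⁺; ∈-allFin; ∈-lookup)
import Data.List.Membership.Setoid.Properties as SetoidMembershipProperties
open import Data.List.Properties using (length-++; length-map; map-++)
open import Data.List.Relation.Unary.All as All using (All)
import Data.List.Relation.Unary.All.Properties as All
open import Data.List.Relation.Unary.AllPairs using (_∷_)
open import Data.List.Relation.Unary.Any using (here; index)
open import Data.List.Relation.Unary.Any.Properties using (lookup-index)
import Data.List.Relation.Unary.Unique.Setoid as UniqueSetoid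
open import Data.Nat.Base as ℕ using (ℕ; zero; suc)
open import Data.Nat.DivMod using (_mod_)
import Data.Nat.ListAction as ListAction
open import Data.Nat.ListAction.Properties using (sum-++)
import Data.Nat.Properties as ℕ
open import Data.Nat.Solver using (module +-*-Solver)
open import Data.Product.Base using (∃-syntax; _×_; _,_; proj₁; proj₂)
open import Data.Rational.Base using (ℚ; mkℚ; Positive; NonNegative; NonZero; 1ℚ; *<*; ↧ₙ_; toℚᵘ)
import Data.Rational.Properties as ℚ
open import Data.Rational.Unnormalised.Base as ℚᵘ using (mkℚᵘ; _≃_)
import Data.Rational.Unnormalised.Properties as ℚᵘ
open import Data.Sum.Base as Sum using (_⊎_; inj₁; inj₂)
open import Data.Vec.Base as Vec using (Vec; []; _∷_; lookup)
open import Data.Vec.Properties using (lookup∘tabulate; []=⇒lookup; lookup⇒[]=)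
open import Function.Base using (_∘_; id)
open import Induction.WellFounded using (Acc; acc)
open import Level using (0ℓ)
open import Relation.Binary.Bundles using (Setoid)
open import Relation.Binary.PropositionalEquality
  using (_≡_; _≢_; refl; sym; trans; cong; cong₂; subst₂; module ≡-Reasoning)
open import Relation.Nullary using (¬_; Dec; yes; no; does; contradiction)
open import Relation.Nullary.Decidable
  using (from-yes; ¬?; _×-dec_; _→-dec_; _⊎-dec_; dec-true)

private variable
  m n : ℕ

-- The field of three elements

-- Opaque, since unification unfolds modular arithmetic on open terms without end.
opaque
  _+₃_ _*₃_ : Fin 3 → Fin 3 → Fin 3
  _+₃_ = AbelianGroup._∙_ ℤ/3
  i *₃ j = (toℕ i ℕ.* toℕ j) mod 3

  -₃_ : Fin 3 → Fin 3
  -₃_ = AbelianGroup._⁻¹ ℤ/3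

  isCommutativeRing₃ : IsCommutativeRing _≡_ _+₃_ _*₃_ -₃_ zero (suc zero)
  isCommutativeRing₃ = record
    { isRing = record
      { +-isAbelianGroup = AbelianGroup.isAbelianGroup ℤ/3
      ; *-cong     = cong₂ _*₃_
      ; *-assoc    = from-yes (all? λ i → all? λ j → all? λ k →
          ((i *₃ j) *₃ k) Fin.≟ (i *₃ (j *₃ k)))
      ; *-identity = from-yes (all? λ i → (suc zero *₃ i) Fin.≟ i)
                   , from-yes (all? λ i → (i *₃ suc zero) Fin.≟ i)
      ; distrib    = from-yes (all? λ i → all? λ j → all? λ k →
          (i *₃ (j +₃ k)) Fin.≟ ((i *₃ j) +₃ (i *₃ k)))
                   , from-yes (all? λ i → all? λ j → all? λ k →
          ((j +₃ k) *₃ i) Fin.≟ ((j *₃ i) +₃ (k *₃ i)))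
      }
    ; *-comm = from-yes (all? λ i → all? λ j → (i *₃ j) Fin.≟ (j *₃ i))
    }

F₃ : CommutativeRing 0ℓ 0ℓ
F₃ = record { isCommutativeRing = isCommutativeRing₃ }

module _ where
  open CommutativeRing F₃
    using (_+_; _*_; -_; 0#; 1#; *-assoc; *-comm; *-identityʳ; zeroˡ; zeroʳ; distribʳ
          ; +-identityʳ; semiring; *-commutativeMonoid
          ; *-commutativeSemigroup; +-abelianGroup)
  open RawSemiring (Semiring.rawSemiring semiring) using (_^_)
  open SemiringSum semiring
    using (sum; sum-syntax; sum-cong-≗; sum-replicate-zero; sum-remove; ∑-distrib-+; ∑-comm
          ; *-distribˡ-sum; *-distribʳ-sum)
  open CommutativeMonoidSum *-commutativeMonoid
    using () renaming (sum to ∏; sum-cong-≗ to ∏-cong; sum-replicate-zero to ∏-replicate-1)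
  open CommutativeSemigroupProperties *-commutativeSemigroup using (interchange; x∙yz≈y∙xz)

  -- Sums, products and pairings over F₃

  ∏-zero : (f : Fin n → Fin 3) → ∀ i → f i ≡ 0# → ∏ f ≡ 0#
  ∏-zero f zero    e = trans (cong (_* ∏ (f ∘ suc)) e) (zeroˡ (∏ (f ∘ suc)))
  ∏-zero f (suc i) e = trans (cong (f zero *_) (∏-zero (f ∘ suc) i e)) (zeroʳ (f zero))

  sum-supported : (f : Fin n → Fin 3) → ∀ i → (∀ j → j ≢ i → f j ≡ 0#) → sum f ≡ f i
  sum-supported {suc n} f i off = begin
    sum f                        ≡⟨ sum-remove {i = i} f ⟩
    f i + sum (f ∘ punchIn i)    ≡⟨ cong (f i +_) (sum-cong-≗ λ j → off (punchIn i j) (punchInᵢ≢i i j)) ⟩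
    f i + ∑[ _ < n ] 0#          ≡⟨ cong (f i +_) (sum-replicate-zero n) ⟩
    f i + 0#                     ≡⟨ +-identityʳ (f i) ⟩
    f i                          ∎
    where open ≡-Reasoning

  -- The recursion on the length of words runs parallel to that of `∏`, which makes `∏-expand` a
  -- plain induction.
  ∑ʷ : ∀ n → (Vec (Fin 3) n → Fin 3) → Fin 3
  ∑ʷ zero    f = f []
  ∑ʷ (suc n) f = ∑[ a < 3 ] ∑ʷ n (f ∘ (a ∷_))

  ∑ʷ-cong : ∀ n {f g : Vec (Fin 3) n → Fin 3} → (∀ α → f α ≡ g α) → ∑ʷ n f ≡ ∑ʷ n g
  ∑ʷ-cong zero    f≗g = f≗g []
  ∑ʷ-cong (suc n) f≗g = sum-cong-≗ λ a → ∑ʷ-cong n (f≗g ∘ (a ∷_))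

  ∑ʷ-zero : ∀ n {f : Vec (Fin 3) n → Fin 3} → (∀ α → f α ≡ 0#) → ∑ʷ n f ≡ 0#
  ∑ʷ-zero zero    f≗0 = f≗0 []
  ∑ʷ-zero (suc n) f≗0 = trans (sum-cong-≗ λ a → ∑ʷ-zero n (f≗0 ∘ (a ∷_))) (sum-replicate-zero 3)

  *-distribˡ-∑ʷ : ∀ n c (f : Vec (Fin 3) n → Fin 3) → c * ∑ʷ n f ≡ ∑ʷ n λ α → c * f α
  *-distribˡ-∑ʷ zero    c f = refl
  *-distribˡ-∑ʷ (suc n) c f = trans
    (*-distribˡ-sum c (λ a → ∑ʷ n (f ∘ (a ∷_))))
    (sum-cong-≗ λ a → *-distribˡ-∑ʷ n c (f ∘ (a ∷_)))

  ⟨_,_⟩ : (Fin m → Fin 3) → (Fin m → Fin 3) → Fin 3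
  ⟨ d , f ⟩ = sum λ j → d j * f j

  ⟨⟩-congʳ : ∀ (d : Fin m → Fin 3) {f g} → (∀ j → f j ≡ g j) → ⟨ d , f ⟩ ≡ ⟨ d , g ⟩
  ⟨⟩-congʳ d f≗g = sum-cong-≗ λ j → cong (d j *_) (f≗g j)

  ⟨⟩-zeroʳ : ∀ (d : Fin m → Fin 3) {f} → (∀ j → f j ≡ 0#) → ⟨ d , f ⟩ ≡ 0#
  ⟨⟩-zeroʳ {m} d f≗0 = trans
    (sum-cong-≗ λ j → trans (cong (d j *_) (f≗0 j)) (zeroʳ (d j)))
    (sum-replicate-zero m)

  ⟨⟩-supported : ∀ (d f : Fin m → Fin 3) i → (∀ j → j ≢ i → f j ≡ 0#) → ⟨ d , f ⟩ ≡ d i * f i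
  ⟨⟩-supported d f i off = sum-supported _ i λ j j≢i →
    trans (cong (d j *_) (off j j≢i)) (zeroʳ (d j))

  ⟨⟩-+ˡ : ∀ (d e f : Fin m → Fin 3) → ⟨ (λ j → d j + e j) , f ⟩ ≡ ⟨ d , f ⟩ + ⟨ e , f ⟩
  ⟨⟩-+ˡ d e f = trans (sum-cong-≗ λ j → distribʳ (f j) (d j) (e j)) (∑-distrib-+ (λ j → d j * f j) (λ j → e j * f j))

  ⟨⟩-*ˡ : ∀ c (d f : Fin m → Fin 3) → ⟨ d , (λ j → c * f j) ⟩ ≡ c * ⟨ d , f ⟩
  ⟨⟩-*ˡ c d f = trans (sum-cong-≗ λ j → x∙yz≈y∙xz (d j) c (f j)) (sym (*-distribˡ-sum c λ j → d j * f j))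

  ⟨⟩-*ʳ : ∀ c (d f : Fin m → Fin 3) → ⟨ d , (λ j → f j * c) ⟩ ≡ ⟨ d , f ⟩ * c
  ⟨⟩-*ʳ c d f = trans (sum-cong-≗ λ j → sym (*-assoc (d j) (f j) c)) (sym (*-distribʳ-sum c λ j → d j * f j))

  ⟨⟩-∑ʷ : ∀ n (d : Fin m → Fin 3) (f : Fin m → Vec (Fin 3) n → Fin 3) →
          ⟨ d , (λ j → ∑ʷ n (f j)) ⟩ ≡ ∑ʷ n λ α → ⟨ d , (λ j → f j α) ⟩
  ⟨⟩-∑ʷ zero    d f = refl
  ⟨⟩-∑ʷ {m} (suc n) d f = begin
    ⟨ d , (λ j → ∑ʷ (suc n) (f j)) ⟩                    ≡⟨ sum-cong-≗ (λ j → *-distribˡ-sum (d j) (λ a → ∑ʷ n (f j ∘ (a ∷_)))) ⟩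
    ∑[ j < m ] (∑[ a < 3 ] (d j * ∑ʷ n (f j ∘ (a ∷_)))) ≡⟨ ∑-comm (λ j a → d j * ∑ʷ n (f j ∘ (a ∷_))) ⟩
    ∑[ a < 3 ] ⟨ d , (λ j → ∑ʷ n (f j ∘ (a ∷_))) ⟩      ≡⟨ sum-cong-≗ (λ a → ⟨⟩-∑ʷ n d λ j → f j ∘ (a ∷_)) ⟩
    ∑ʷ (suc n) (λ α → ⟨ d , (λ j → f j α) ⟩)            ∎
    where open ≡-Reasoning

  -- Homogeneous linear systems over F₃

  funToFin-cong : {f g : Fin m → Fin n} → (∀ i → f i ≡ g i) → funToFin f ≡ funToFin g
  funToFin-cong {zero}  f≗g = refl
  funToFin-cong {suc m} f≗g = cong₂ combine (f≗g zero) (funToFin-cong (f≗g ∘ suc))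

  opaque
    unfolding _+₃_

    x-y≡0⇒x≡y : ∀ x y → x + - y ≡ 0# → x ≡ y
    x-y≡0⇒x≡y = from-yes (all? λ x → all? λ y → (x + - y Fin.≟ 0#) →-dec (x Fin.≟ y))

    x-y+y≡x : ∀ x y → (x + - y) + y ≡ x
    x-y+y≡x = from-yes (all? λ x → all? λ y → (x + - y) + y Fin.≟ x)

  -- Two of the 3^m vectors have the same pairings with all rows; take their difference.
  nontrivial-solution : ∀ (rows : List (Fin m → Fin 3)) → length rows ℕ.< m →
    ∃[ d ] (∃[ i ] d i ≢ 0#) × All (λ r → ⟨ d , r ⟩ ≡ 0#) rows
  nontrivial-solution {m} rows k<m = d , (i , dᵢ≢0) , All.tabulate λ r∈ →
    trans (cong ⟨ d ,_⟩ (lookup-index r∈)) (d⊥ (index r∈))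
    where
    open AbelianGroupProperties +-abelianGroup using (identityˡ-unique)
    -- Vectors and their lists of pairings are both coded as numbers, so that `pigeonhole` applies
    -- with 3 ^ `length rows` < 3 ^ m.
    pairings : Fin (3 ℕ.^ m) → Fin (3 ℕ.^ length rows)
    pairings c = funToFin λ r → ⟨ finToFun c , List.lookup rows r ⟩
    collision = pigeonhole (ℕ.^-monoʳ-< 3 (ℕ.s≤s (ℕ.s≤s ℕ.z≤n)) k<m) pairings
    s = proj₁ collision
    t = proj₁ (proj₂ collision)
    u v d : Fin m → Fin 3
    u = finToFun s
    v = finToFun t
    d j = u j + - v j
    u≢v : ∃[ i ] u i ≢ v i
    u≢v = ¬∀⟶∃¬ m _ (λ i → u i Fin.≟ v i) λ u≗v →
      Fin.<⇒≢ (proj₁ (proj₂ (proj₂ collision)))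
        (trans (sym (funToFin-finToFin {m} s)) (trans (funToFin-cong u≗v) (funToFin-finToFin {m} t)))
    i = proj₁ u≢v
    dᵢ≢0 : d i ≢ 0#
    dᵢ≢0 e = proj₂ u≢v (x-y≡0⇒x≡y (u i) (v i) e)
    d⊥ : ∀ r → ⟨ d , List.lookup rows r ⟩ ≡ 0#
    -- Since d + v = u, and u and v pair equally with w, adding ⟨ d , w ⟩ to ⟨ v , w ⟩ changes
    -- nothing.
    d⊥ r = identityˡ-unique ⟨ d , w ⟩ ⟨ v , w ⟩ (begin
      ⟨ d , w ⟩ + ⟨ v , w ⟩       ≡⟨ ⟨⟩-+ˡ d v w ⟨
      ⟨ (λ j → d j + v j) , w ⟩   ≡⟨ sum-cong-≗ (λ j → cong (_* w j) (x-y+y≡x (u j) (v j))) ⟩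
      ⟨ u , w ⟩                   ≡⟨ finToFun-funToFin _ r ⟨
      finToFun (pairings s) r     ≡⟨ cong (λ c → finToFun c r) (proj₂ (proj₂ (proj₂ collision))) ⟩
      finToFun (pairings t) r     ≡⟨ finToFun-funToFin _ r ⟩
      ⟨ v , w ⟩                   ∎)
      where
      open ≡-Reasoning
      w = List.lookup rows r

  -- The polynomial ∏ᵢ (1 - (xᵢ + yᵢ + zᵢ)²)

  -- The coefficients of 1 - (x + y + z)².
  coef : Fin 3 → Fin 3 → Fin 3 → Fin 3
  coef zero             zero             zero             = 1#
  coef (suc (suc zero)) zero             zero             = - 1#
  coef zero             (suc (suc zero)) zero             = - 1#
  coef zero             zero             (suc (suc zero)) = - 1#
  coef (suc zero)       (suc zero)       zero             = 1#
  coef zero             (suc zero)       (suc zero)       = 1#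
  coef (suc zero)       zero             (suc zero)       = 1#
  coef _                _                _                = 0#

  -- The coefficient of x^a y^b in 1 - (x + y + z)², as a polynomial in z. Nesting the expansion in
  -- this way lets `∏-expand` extract one variable at a time.
  coefᶻ : Fin 3 → Fin 3 → Fin 3 → Fin 3
  coefᶻ a b z = ∑[ c < 3 ] (z ^ toℕ c * coef a b c)

  coefʸᶻ : Fin 3 → Fin 3 → Fin 3 → Fin 3
  coefʸᶻ a y z = ∑[ b < 3 ] (y ^ toℕ b * coefᶻ a b z)

  1-[x+y+z]² : Fin 3 → Fin 3 → Fin 3 → Fin 3
  1-[x+y+z]² x y z = ∑[ a < 3 ] (x ^ toℕ a * coefʸᶻ a y z)

  opaque
    unfolding _+₃_

    -- The only nonzero square in F₃ is 1.
    1-[x+y+z]²≡0∨x+y+z≡0 : ∀ x y z → 1-[x+y+z]² x y z ≡ 0# ⊎ x + (y + z) ≡ 0#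
    1-[x+y+z]²≡0∨x+y+z≡0 = from-yes (all? λ x → all? λ y → all? λ z →
      (1-[x+y+z]² x y z Fin.≟ 0#) ⊎-dec (x + (y + z) Fin.≟ 0#))

    1-[x+x+x]²≡1 : ∀ x → 1-[x+y+z]² x x x ≡ 1#
    1-[x+x+x]²≡1 = from-yes (all? λ x → 1-[x+y+z]² x x x Fin.≟ 1#)

    coef≡0∨deg≤2 : ∀ a b c → coef a b c ≡ 0# ⊎ toℕ a ℕ.+ toℕ b ℕ.+ toℕ c ℕ.≤ 2
    coef≡0∨deg≤2 = from-yes (all? λ a → all? λ b → all? λ c →
      (coef a b c Fin.≟ 0#) ⊎-dec (toℕ a ℕ.+ toℕ b ℕ.+ toℕ c ℕ.≤? 2))

  Point : ℕ → Set
  Point n = Fin n → Fin 3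

  Word : ℕ → Set
  Word n = Vec (Fin 3) n

  monomial : Word n → Point n → Fin 3
  monomial α x = ∏ λ i → x i ^ toℕ (lookup α i)

  coefficient : Word n → Word n → Word n → Fin 3
  coefficient α β γ = ∏ λ i → coef (lookup α i) (lookup β i) (lookup γ i)

  coefficientᶻ : Word n → Word n → Point n → Fin 3
  coefficientᶻ α β z = ∏ λ i → coefᶻ (lookup α i) (lookup β i) (z i)

  coefficientʸᶻ : Word n → Point n → Point n → Fin 3
  coefficientʸᶻ α y z = ∏ λ i → coefʸᶻ (lookup α i) (y i) (z i)

  sumsToZero : Point n → Point n → Point n → Fin 3
  sumsToZero x y z = ∏ λ i → 1-[x+y+z]² (x i) (y i) (z i)

  -- By distributivity: the word α records which exponent is picked in each coordinate. It is used
  -- for x, y and z in turn, with q holding the part in the variables not yet expanded.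
  ∏-expand : ∀ (x : Point n) (q : Fin n → Fin 3 → Fin 3) →
    ∏ (λ i → ∑[ a < 3 ] (x i ^ toℕ a * q i a)) ≡
    ∑ʷ n (λ α → monomial α x * ∏ λ i → q i (lookup α i))
  ∏-expand {zero}  x q = sym (*-identityʳ 1#)
  ∏-expand {suc n} x q = begin
    sum (λ a → p a * q zero a) * ∏ (λ i → ∑[ a < 3 ] (x (suc i) ^ toℕ a * q (suc i) a))
      ≡⟨ cong (sum (λ a → p a * q zero a) *_) (∏-expand (x ∘ suc) (q ∘ suc)) ⟩
    sum (λ a → p a * q zero a) * ∑ʷ n r
      ≡⟨ *-distribʳ-sum (∑ʷ n r) (λ a → p a * q zero a) ⟩
    sum (λ a → p a * q zero a * ∑ʷ n r)
      ≡⟨ sum-cong-≗ (λ a → trans (*-distribˡ-∑ʷ n (p a * q zero a) r)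
           (∑ʷ-cong n λ α → interchange (p a) (q zero a) (monomial α (x ∘ suc)) (∏ λ i → q (suc i) (lookup α i)))) ⟩
    ∑ʷ (suc n) (λ α → monomial α x * ∏ λ i → q i (lookup α i)) ∎
    where
    open ≡-Reasoning
    p : Fin 3 → Fin 3
    p a = x zero ^ toℕ a
    r : Word n → Fin 3
    r α = monomial α (x ∘ suc) * ∏ λ i → q (suc i) (lookup α i)

  -- Degrees and low exponents

  degree : Word n → ℕ
  degree []      = 0
  degree (a ∷ α) = toℕ a ℕ.+ degree α

  -- Each coordinate contributes a factor of total degree at most 2, and a single vanishing factor
  -- kills the product.
  coefficient≡0∨deg≤2n : ∀ (α β γ : Word n) →
    coefficient α β γ ≡ 0# ⊎ degree α ℕ.+ degree β ℕ.+ degree γ ℕ.≤ n ℕ.* 2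
  coefficient≡0∨deg≤2n [] [] [] = inj₂ ℕ.z≤n
  coefficient≡0∨deg≤2n (a ∷ α) (b ∷ β) (c ∷ γ)
    with coef≡0∨deg≤2 a b c | coefficient≡0∨deg≤2n α β γ
  ... | inj₁ e | _      = inj₁ (trans (cong (_* coefficient α β γ) e) (zeroˡ (coefficient α β γ)))
  ... | inj₂ _ | inj₁ e = inj₁ (trans (cong (coef a b c *_) e) (zeroʳ (coef a b c)))
  ... | inj₂ p | inj₂ q = inj₂ (ℕ.≤-trans (ℕ.≤-reflexive regroup) (ℕ.+-mono-≤ p q))
    where
    open CommutativeSemigroupProperties ℕ.+-commutativeSemigroup using () renaming (interchange to +-interchange)
    regroup : toℕ a ℕ.+ degree α ℕ.+ (toℕ b ℕ.+ degree β) ℕ.+ (toℕ c ℕ.+ degree γ) ≡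
              toℕ a ℕ.+ toℕ b ℕ.+ toℕ c ℕ.+ (degree α ℕ.+ degree β ℕ.+ degree γ)
    regroup = trans
      (cong (ℕ._+ (toℕ c ℕ.+ degree γ)) (+-interchange (toℕ a) (degree α) (toℕ b) (degree β)))
      (+-interchange (toℕ a ℕ.+ toℕ b) (degree α ℕ.+ degree β) (toℕ c) (degree γ))

  -- The bound 2n/3 on the degree, with its denominator cleared.
  Low : Word n → Set
  Low {n} α = degree α ℕ.* 3 ℕ.≤ n ℕ.* 2

  low? : (α : Word n) → Dec (Low α)
  low? {n} α = degree α ℕ.* 3 ℕ.≤? n ℕ.* 2

  -- Three degrees above 2n/3 add up to more than 2n.
  coefficient-low : ∀ (α β γ : Word n) → ¬ Low α → ¬ Low β → ¬ Low γ → coefficient α β γ ≡ 0#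
  coefficient-low {n} α β γ ¬α ¬β ¬γ with coefficient≡0∨deg≤2n α β γ
  ... | inj₁ e = e
  ... | inj₂ p = contradiction (begin-strict
      n ℕ.* 2 ℕ.+ n ℕ.* 2 ℕ.+ n ℕ.* 2                              <⟨ ℕ.+-mono-< (ℕ.+-mono-< (ℕ.≰⇒> ¬α) (ℕ.≰⇒> ¬β)) (ℕ.≰⇒> ¬γ) ⟩
      degree α ℕ.* 3 ℕ.+ degree β ℕ.* 3 ℕ.+ degree γ ℕ.* 3         ≡⟨ cong (ℕ._+ degree γ ℕ.* 3) (ℕ.*-distribʳ-+ 3 (degree α) (degree β)) ⟨
      (degree α ℕ.+ degree β) ℕ.* 3 ℕ.+ degree γ ℕ.* 3             ≡⟨ ℕ.*-distribʳ-+ 3 (degree α ℕ.+ degree β) (degree γ) ⟨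
      (degree α ℕ.+ degree β ℕ.+ degree γ) ℕ.* 3                   ≤⟨ ℕ.*-monoˡ-≤ 3 p ⟩
      n ℕ.* 2 ℕ.* 3                                                ≡⟨ triple (n ℕ.* 2) ⟩
      n ℕ.* 2 ℕ.+ n ℕ.* 2 ℕ.+ n ℕ.* 2                              ∎) (ℕ.<-irrefl refl)
    where
    open ℕ.≤-Reasoning
    triple : ∀ t → t ℕ.* 3 ≡ t ℕ.+ t ℕ.+ t
    triple t = trans (ℕ.*-comm t 3) (trans (cong (t ℕ.+_) (cong (t ℕ.+_) (ℕ.+-identityʳ t))) (sym (ℕ.+-assoc t t t)))

  -- Contracting the polynomial with annihilators

  module _ (x : Fin m → Point n) where

    Annihilates : (Fin m → Fin 3) → Set
    Annihilates d = ∀ α → Low α → ⟨ d , monomial α ∘ x ⟩ ≡ 0#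

    -- The coefficient of y^α in ∑ₖ h(k) F(y, xⱼ, xₖ). For fixed h and α, its orthogonality to d is
    -- one linear equation in d.
    contraction : (Fin m → Fin 3) → Word n → Fin m → Fin 3
    contraction h α j = ⟨ h , (λ k → coefficientʸᶻ α (x j) (x k)) ⟩

    -- With α high, a monomial of F has β low, which d kills, or γ low, which h kills, or else a
    -- zero coefficient by `coefficient-low`.
    contraction-⊥ : ∀ d h → Annihilates d → Annihilates h →
                    ∀ α → ¬ Low α → ⟨ d , contraction h α ⟩ ≡ 0#
    contraction-⊥ d h d⊥ h⊥ α ¬α = begin
      ⟨ d , contraction h α ⟩
        ≡⟨ ⟨⟩-congʳ d (λ j → begin
             ⟨ h , (λ k → coefficientʸᶻ α (x j) (x k)) ⟩
               ≡⟨ ⟨⟩-congʳ h (λ k → ∏-expand (x j) (λ i b → coefᶻ (lookup α i) b (x k i))) ⟩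
             ⟨ h , (λ k → ∑ʷ n (λ β → monomial β (x j) * coefficientᶻ α β (x k))) ⟩
               ≡⟨ ⟨⟩-∑ʷ n h _ ⟩
             ∑ʷ n (λ β → ⟨ h , (λ k → monomial β (x j) * coefficientᶻ α β (x k)) ⟩)
               ≡⟨ ∑ʷ-cong n (λ β → ⟨⟩-*ˡ (monomial β (x j)) h (λ k → coefficientᶻ α β (x k))) ⟩
             ∑ʷ n (λ β → monomial β (x j) * c β) ∎) ⟩
      ⟨ d , (λ j → ∑ʷ n (λ β → monomial β (x j) * c β)) ⟩
        ≡⟨ ⟨⟩-∑ʷ n d _ ⟩
      ∑ʷ n (λ β → ⟨ d , (λ j → monomial β (x j) * c β) ⟩)
        ≡⟨ ∑ʷ-cong n (λ β → ⟨⟩-*ʳ (c β) d (monomial β ∘ x)) ⟩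
      ∑ʷ n (λ β → ⟨ d , monomial β ∘ x ⟩ * c β)
        ≡⟨ ∑ʷ-zero n vanish ⟩
      0# ∎
      where
      open ≡-Reasoning
      -- What remains of the coefficient of x^α y^β once the third variable is paired with h.
      c : Word n → Fin 3
      c β = ⟨ h , coefficientᶻ α β ∘ x ⟩
      c≡0 : ∀ β → ¬ Low β → c β ≡ 0#
      c≡0 β ¬β = begin
        ⟨ h , coefficientᶻ α β ∘ x ⟩
          ≡⟨ ⟨⟩-congʳ h (λ k → ∏-expand (x k) (λ i → coef (lookup α i) (lookup β i))) ⟩
        ⟨ h , (λ k → ∑ʷ n (λ γ → monomial γ (x k) * coefficient α β γ)) ⟩
          ≡⟨ ⟨⟩-∑ʷ n h _ ⟩
        ∑ʷ n (λ γ → ⟨ h , (λ k → monomial γ (x k) * coefficient α β γ) ⟩)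
          ≡⟨ ∑ʷ-cong n (λ γ → ⟨⟩-*ʳ (coefficient α β γ) h (monomial γ ∘ x)) ⟩
        ∑ʷ n (λ γ → ⟨ h , monomial γ ∘ x ⟩ * coefficient α β γ)
          ≡⟨ ∑ʷ-zero n (λ γ → vanishᶻ γ (low? γ)) ⟩
        0# ∎
        where
        vanishᶻ : ∀ γ → Dec (Low γ) → ⟨ h , monomial γ ∘ x ⟩ * coefficient α β γ ≡ 0#
        vanishᶻ γ (yes lowγ) = trans (cong (_* coefficient α β γ) (h⊥ γ lowγ)) (zeroˡ (coefficient α β γ))
        vanishᶻ γ (no ¬γ)    = trans
          (cong (⟨ h , monomial γ ∘ x ⟩ *_) (coefficient-low α β γ ¬α ¬β ¬γ))
          (zeroʳ ⟨ h , monomial γ ∘ x ⟩)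
      vanish : ∀ β → ⟨ d , monomial β ∘ x ⟩ * c β ≡ 0#
      vanish β with low? β
      ... | yes lowβ = trans (cong (_* c β) (d⊥ β lowβ)) (zeroˡ (c β))
      ... | no ¬β    = trans (cong (⟨ d , monomial β ∘ x ⟩ *_) (c≡0 β ¬β)) (zeroʳ ⟨ d , monomial β ∘ x ⟩)

    -- As a polynomial in y the double sum has all coefficients zero: the low ones by hypothesis,
    -- the others by `contraction-⊥`.
    sumsToZero-⊥ : ∀ d h → Annihilates d → Annihilates h →
                   (∀ α → Low α → ⟨ d , contraction h α ⟩ ≡ 0#) →
                   ∀ y → ⟨ d , (λ j → ⟨ h , (λ k → sumsToZero y (x j) (x k)) ⟩) ⟩ ≡ 0#
    sumsToZero-⊥ d h d⊥ h⊥ d⊥K y = begin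
      ⟨ d , (λ j → ⟨ h , (λ k → sumsToZero y (x j) (x k)) ⟩) ⟩
        ≡⟨ ⟨⟩-congʳ d (λ j → begin
             ⟨ h , (λ k → sumsToZero y (x j) (x k)) ⟩
               ≡⟨ ⟨⟩-congʳ h (λ k → ∏-expand y (λ i a → coefʸᶻ a (x j i) (x k i))) ⟩
             ⟨ h , (λ k → ∑ʷ n (λ α → monomial α y * coefficientʸᶻ α (x j) (x k))) ⟩
               ≡⟨ ⟨⟩-∑ʷ n h _ ⟩
             ∑ʷ n (λ α → ⟨ h , (λ k → monomial α y * coefficientʸᶻ α (x j) (x k)) ⟩)
               ≡⟨ ∑ʷ-cong n (λ α → ⟨⟩-*ˡ (monomial α y) h (λ k → coefficientʸᶻ α (x j) (x k))) ⟩
             ∑ʷ n (λ α → monomial α y * contraction h α j) ∎) ⟩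
      ⟨ d , (λ j → ∑ʷ n (λ α → monomial α y * contraction h α j)) ⟩
        ≡⟨ ⟨⟩-∑ʷ n d _ ⟩
      ∑ʷ n (λ α → ⟨ d , (λ j → monomial α y * contraction h α j) ⟩)
        ≡⟨ ∑ʷ-cong n (λ α → ⟨⟩-*ˡ (monomial α y) d (contraction h α)) ⟩
      ∑ʷ n (λ α → monomial α y * ⟨ d , contraction h α ⟩)
        ≡⟨ ∑ʷ-zero n (λ α → trans (cong (monomial α y *_) (vanish α)) (zeroʳ (monomial α y))) ⟩
      0# ∎
      where
      open ≡-Reasoning
      vanish : ∀ α → ⟨ d , contraction h α ⟩ ≡ 0#
      vanish α with low? α
      ... | yes lowα = d⊥K α lowα
      ... | no ¬α    = contraction-⊥ d h d⊥ h⊥ α ¬α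

  -- The dimension argument

  sumsToZero-diagonal : ∀ (x : Point n) → sumsToZero x x x ≡ 1#
  sumsToZero-diagonal {n} x = trans (∏-cong λ i → 1-[x+x+x]²≡1 (x i)) (∏-replicate-1 n)

  sumsToZero≡0∨x+y+z≡0 : ∀ (x y z : Point n) →
    sumsToZero x y z ≡ 0# ⊎ (∀ i → x i + (y i + z i) ≡ 0#)
  sumsToZero≡0∨x+y+z≡0 x y z with all? (λ i → x i + (y i + z i) Fin.≟ 0#)
  ... | yes s≡0 = inj₂ s≡0
  ... | no s≢0 with i , sᵢ≢0 ← ¬∀⟶∃¬ _ _ (λ i → x i + (y i + z i) Fin.≟ 0#) s≢0
    with 1-[x+y+z]²≡0∨x+y+z≡0 (x i) (y i) (z i)
  ...   | inj₁ e = inj₁ (∏-zero _ i e)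
  ...   | inj₂ e = contradiction e sᵢ≢0

  module _ (x : Fin m → Point n)
           (diagonal : ∀ i j k → i ≢ j ⊎ i ≢ k → sumsToZero (x i) (x j) (x k) ≡ 0#) where

    -- In the double sum of `sumsToZero-⊥` at y = xᵢ only the term j = k = i survives, and there F
    -- equals 1.
    disjoint : ∀ d h → Annihilates x d → Annihilates x h →
               (∀ α → Low α → ⟨ d , contraction x h α ⟩ ≡ 0#) → ∀ i → d i * h i ≡ 0#
    disjoint d h d⊥ h⊥ d⊥K i = begin
      d i * h i                                        ≡⟨ cong (d i *_) inner ⟨
      d i * ⟨ h , F i ⟩                                ≡⟨ ⟨⟩-supported d (λ j → ⟨ h , F j ⟩) i outer ⟨
      ⟨ d , (λ j → ⟨ h , F j ⟩) ⟩                      ≡⟨ sumsToZero-⊥ x d h d⊥ h⊥ d⊥K (x i) ⟩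
      0#                                               ∎
      where
      open ≡-Reasoning
      F : Fin m → Fin m → Fin 3
      F j k = sumsToZero (x i) (x j) (x k)
      outer : ∀ j → j ≢ i → ⟨ h , F j ⟩ ≡ 0#
      outer j j≢i = ⟨⟩-zeroʳ h λ k → diagonal i j k (inj₁ (j≢i ∘ sym))
      inner : ⟨ h , F i ⟩ ≡ h i
      inner = begin
        ⟨ h , F i ⟩   ≡⟨ ⟨⟩-supported h (F i) i (λ k k≢i → diagonal i i k (inj₂ (k≢i ∘ sym))) ⟩
        h i * F i i   ≡⟨ cong (h i *_) (sumsToZero-diagonal (x i)) ⟩
        h i * 1#      ≡⟨ *-identityʳ (h i) ⟩
        h i           ∎

  -- The complement of the support: growth of the support becomes descent for `⊂`, which is
  -- well-founded.
  zeros : (Fin m → Fin 3) → Subset m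
  zeros h = Vec.tabulate λ i → does (h i Fin.≟ 0#)

  ∈-zeros⁺ : ∀ (h : Fin m → Fin 3) i → h i ≡ 0# → i ∈ zeros h
  ∈-zeros⁺ h i e = lookup⇒[]= i (zeros h) (trans (lookup∘tabulate _ i) (dec-true (h i Fin.≟ 0#) e))

  ∈-zeros⁻ : ∀ (h : Fin m → Fin 3) i → i ∈ zeros h → h i ≡ 0#
  ∈-zeros⁻ h i i∈ with h i Fin.≟ 0# | trans (sym (lookup∘tabulate (λ i → does (h i Fin.≟ 0#)) i)) ([]=⇒lookup i∈)
  ... | yes e | _  = e
  ... | no _  | ()

  opaque
    unfolding _+₃_

    x*y≡0∧x+y≡0⇒y≡0 : ∀ x y → x * y ≡ 0# → y + x ≡ 0# → y ≡ 0#
    x*y≡0∧x+y≡0⇒y≡0 = from-yes (all? λ x → all? λ y →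
      (x * y Fin.≟ 0#) →-dec (y + x Fin.≟ 0#) →-dec (y Fin.≟ 0#))

    x≢0∧x*y≡0⇒y≡0∧y+x≢0 : ∀ x y → x ≢ 0# → x * y ≡ 0# → y ≡ 0# × y + x ≢ 0#
    x≢0∧x*y≡0⇒y≡0∧y+x≢0 = from-yes (all? λ x → all? λ y →
      ¬? (x Fin.≟ 0#) →-dec (x * y Fin.≟ 0#) →-dec (y Fin.≟ 0#) ×-dec ¬? (y + x Fin.≟ 0#))

  -- The supports of d and h are disjoint, so nothing cancels in h + d, and the zero of h at i is
  -- lost.
  zeros-+ : ∀ (d h : Fin m → Fin 3) → (∀ i → d i * h i ≡ 0#) → ∃[ i ] d i ≢ 0# →
            zeros (λ i → h i + d i) ⊂ zeros h
  zeros-+ d h dh≡0 (i , dᵢ≢0) =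
    (λ {j} j∈ → ∈-zeros⁺ h j (x*y≡0∧x+y≡0⇒y≡0 (d j) (h j) (dh≡0 j) (∈-zeros⁻ (λ i → h i + d i) j j∈))) ,
    i , ∈-zeros⁺ h i (proj₁ zs) , proj₂ zs ∘ ∈-zeros⁻ (λ i → h i + d i) i
    where zs = x≢0∧x*y≡0⇒y≡0∧y+x≢0 (d i) (h i) dᵢ≢0 (dh≡0 i)

  -- Low words and the bound 2N

  words : ∀ n → List (Word n)
  words zero    = [] ∷ []
  words (suc n) = cartesianProductWith _∷_ (allFin 3) (words n)

  ∈-words : ∀ (α : Word n) → α ∈ˡ words n
  ∈-words []      = here refl
  ∈-words (a ∷ α) = ∈-cartesianProductWith⁺ _∷_ (∈-allFin a) (∈-words α)

  lowWords : ∀ n → List (Word n)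
  lowWords n = filter low? (words n)

  ∈-lowWords : ∀ (α : Word n) → Low α → α ∈ˡ lowWords n
  ∈-lowWords α = ∈-filter⁺ low? (∈-words α)

  diagonal⇒≤ : (x : Fin m → Point n) →
               (∀ i j k → i ≢ j ⊎ i ≢ k → sumsToZero (x i) (x j) (x k) ≡ 0#) →
               m ℕ.≤ length (lowWords n) ℕ.+ length (lowWords n)
  diagonal⇒≤ {m} {n} x diagonal = ℕ.≮⇒≥ λ 2N<m →
    no-annihilator 2N<m (λ _ → 0#) (λ α _ → trans (sum-cong-≗ λ j → zeroˡ (monomial α (x j))) (sum-replicate-zero m))
      (⊂-wellFounded _)
    where
    L = lowWords n
    monomials = List.map (λ α → monomial α ∘ x) L
    -- The first N rows make d an annihilator, the other N kill its pairings with the low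
    -- contractions of h.
    rows : (Fin m → Fin 3) → List (Fin m → Fin 3)
    rows h = monomials List.++ List.map (contraction x h) L
    #rows : ∀ h → length (rows h) ≡ length L ℕ.+ length L
    #rows h = trans (length-++ monomials) (cong₂ ℕ._+_ (length-map _ L) (length-map _ L))
    -- Every annihilator yields one with a strictly smaller zero set, so recursion on accessibility
    -- refutes them all, including the zero function.
    no-annihilator : length L ℕ.+ length L ℕ.< m →
                     ∀ h → Annihilates x h → ¬ Acc _⊂_ (zeros h)
    no-annihilator 2N<m h h⊥ (acc smaller) =
      no-annihilator 2N<m (λ i → h i + d i) h+d⊥ (smaller (zeros-+ d h dh≡0 (proj₁ (proj₂ solution))))
      where
      solution = nontrivial-solution (rows h) (ℕ.≤-<-trans (ℕ.≤-reflexive (#rows h)) 2N<m)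
      d = proj₁ solution
      d⊥ = proj₂ (proj₂ solution)
      d⊥x : Annihilates x d
      d⊥x α lowα = All.lookup (All.map⁻ {f = λ α → monomial α ∘ x} (All.++⁻ˡ monomials d⊥)) (∈-lowWords α lowα)
      d⊥K : ∀ α → Low α → ⟨ d , contraction x h α ⟩ ≡ 0#
      d⊥K α lowα = All.lookup (All.map⁻ {f = contraction x h} (All.++⁻ʳ monomials d⊥)) (∈-lowWords α lowα)
      dh≡0 : ∀ i → d i * h i ≡ 0#
      dh≡0 = disjoint x diagonal d h d⊥x h⊥ d⊥K
      h+d⊥ : Annihilates x (λ i → h i + d i)
      h+d⊥ α lowα = trans (⟨⟩-+ˡ h d (monomial α ∘ x))
        (trans (cong₂ _+_ (h⊥ α lowα) (d⊥x α lowα)) (+-identityʳ 0#))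

  -- From progression-free sets to the diagonal condition

  module _ {c ℓ} (S : Setoid c ℓ) where
    open Setoid S using (_≈_) renaming (sym to ≈-sym)

    lookup-injective : ∀ {xs} → UniqueSetoid.Unique S xs →
                       ∀ i j → List.lookup xs i ≈ List.lookup xs j → i ≡ j
    lookup-injective (_ ∷ _)   zero    zero    _ = refl
    lookup-injective (x≉ ∷ _)  zero    (suc j) e = contradiction e (All.lookup x≉ (∈-lookup j))
    lookup-injective (x≉ ∷ _)  (suc i) zero    e = contradiction (≈-sym e) (All.lookup x≉ (∈-lookup i))
    lookup-injective (_ ∷ uxs) (suc i) (suc j) e = cong suc (lookup-injective uxs i j e)

  opaque
    unfolding _+₃_

    private
      module ℤ/3 = AbelianGroup ℤ/3

    -- Stated with the operation of `ℤ/3`, as it occurs in `ContainsThreeTermAP`; inside this block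
    -- it agrees with `_+₃_`.
    common-difference : ∀ x y → x ℤ/3.∙ (y + - x) ≡ y
    common-difference = from-yes (all? λ x → all? λ y → x ℤ/3.∙ (y + - x) Fin.≟ y)

    -- In characteristic 3, z = - x - y = 2y - x = x + 2(y - x).
    third-term : ∀ x y z → x + (y + z) ≡ 0# → x ℤ/3.∙ ((y + - x) ℤ/3.∙ (y + - x)) ≡ z
    third-term = from-yes (all? λ x → all? λ y → all? λ z →
      (x + (y + z) Fin.≟ 0#) →-dec (x ℤ/3.∙ ((y + - x) ℤ/3.∙ (y + - x)) Fin.≟ z))

    constant-AP : ∀ x y z → x + (y + z) ≡ 0# → y + - x ≡ 0# → x ≡ y × x ≡ z
    constant-AP = from-yes (all? λ x → all? λ y → all? λ z →
      (x + (y + z) Fin.≟ 0#) →-dec (y + - x Fin.≟ 0#) →-dec (x Fin.≟ y) ×-dec (x Fin.≟ z))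

  -- A nonzero value forces x + y + z = 0, a progression with difference y - x. A nonzero difference
  -- contradicts freeness; a zero one makes the three points equal, hence the indices too, as A has
  -- no duplicates.
  APFree⇒diagonal : ∀ (A : List (Point n)) → IsAPFreeSet ([ℤ/3]^ n) A →
    ∀ i j k → i ≢ j ⊎ i ≢ k → sumsToZero (List.lookup A i) (List.lookup A j) (List.lookup A k) ≡ 0#
  APFree⇒diagonal {n} A (unique , free) i j k i≢j∨i≢k =
    Sum.[ id , (λ s≡0 → contradiction s≡0 s≢0) ]′ (sumsToZero≡0∨x+y+z≡0 x y z)
    where
    open AbelianGroup ([ℤ/3]^ n) using (setoid)
    open SetoidMembershipProperties using (∈-resp-≈) renaming (∈-lookup to ∈-lookupₛ)
    x = List.lookup A i
    y = List.lookup A j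
    z = List.lookup A k
    s≢0 : ¬ (∀ t → x t + (y t + z t) ≡ 0#)
    s≢0 s≡0 with all? (λ t → y t + - x t Fin.≟ 0#)
    ... | no h≢0 = free
      ( x , (λ t → y t + - x t) , h≢0 , ∈-lookupₛ setoid A i
      , ∈-resp-≈ setoid (λ t → sym (common-difference (x t) (y t))) (∈-lookupₛ setoid A j)
      , ∈-resp-≈ setoid (λ t → sym (third-term (x t) (y t) (z t) (s≡0 t))) (∈-lookupₛ setoid A k))
    ... | yes h≡0 = Sum.[ (λ i≢j → i≢j (lookup-injective setoid unique i j (proj₁ ∘ constant)))
                        , (λ i≢k → i≢k (lookup-injective setoid unique i k (proj₂ ∘ constant))) ]′ i≢j∨i≢k
      where
      constant : ∀ t → x t ≡ y t × x t ≡ z t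
      constant t = constant-AP (x t) (y t) (z t) (s≡0 t) (h≡0 t)

  r₃≤2N : ∀ n → r₃[ℤ/3]^ n ℕ.≤ length (lowWords n) ℕ.+ length (lowWords n)
  r₃≤2N n with A , free , |A|≡r₃ ← proj₁ (r₃-isMaxAPFreeSize n) =
    ℕ.≤-trans (ℕ.≤-reflexive (sym |A|≡r₃)) (diagonal⇒≤ (List.lookup A) (APFree⇒diagonal A free))

-- Counting low words

module _ where
  open import Data.Nat.Base using (_+_; _*_; _≤_; _<_; _^_)
  open ListAction using (sum)
  open +-*-Solver using (solve; _:+_; _:*_; _:=_; con)
  open CommutativeSemigroupProperties ℕ.*-commutativeSemigroup using (interchange)

  ^-distribʳ-* : ∀ a b n → (a * b) ^ n ≡ a ^ n * b ^ n
  ^-distribʳ-* a b zero    = refl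
  ^-distribʳ-* a b (suc n) = trans (cong (a * b *_) (^-distribʳ-* a b n)) (interchange a b (a ^ n) (b ^ n))

  module _ {A : Set} {P : A → Set} (P? : ∀ x → Dec (P x)) where

    -- Markov's inequality for counting: each element that passes the filter carries weight at least
    -- c.
    length-filter-* : ∀ c (w : A → ℕ) → (∀ x → P x → c ≤ w x) →
                      ∀ xs → length (filter P? xs) * c ≤ sum (List.map w xs)
    length-filter-* c w c≤w []       = ℕ.z≤n
    length-filter-* c w c≤w (x ∷ xs) with P? x
    ... | yes px = ℕ.+-mono-≤ (c≤w x px) (length-filter-* c w c≤w xs)
    ... | no _   = ℕ.≤-trans (length-filter-* c w c≤w xs) (ℕ.m≤n+m _ (w x))

  module _ (P Q : ℕ) where

    -- (P/Q)^a, scaled by Q² to stay in ℕ.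
    weight : Fin 3 → ℕ
    weight zero             = Q * Q
    weight (suc zero)       = P * Q
    weight (suc (suc zero)) = P * P

    wordWeight : Word n → ℕ
    wordWeight []      = 1
    wordWeight (a ∷ α) = weight a * wordWeight α

    totalWeight : ℕ
    totalWeight = sum (List.map weight (allFin 3))

    -- The weight is multiplicative over coordinates, so the sum over all words factors.
    sum-wordWeight : ∀ n → sum (List.map wordWeight (words n)) ≡ totalWeight ^ n
    sum-wordWeight zero    = refl
    sum-wordWeight (suc n) = trans (product (allFin 3)) (cong (totalWeight *_) (sum-wordWeight n))
      where
      open ≡-Reasoning
      prefix : ∀ a (ws : List (Word n)) →
               sum (List.map wordWeight (List.map (a ∷_) ws)) ≡ weight a * sum (List.map wordWeight ws)
      prefix a []       = sym (ℕ.*-zeroʳ (weight a))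
      prefix a (α ∷ ws) = trans (cong (wordWeight (a ∷ α) ℕ.+_) (prefix a ws))
        (sym (ℕ.*-distribˡ-+ (weight a) (wordWeight α) (sum (List.map wordWeight ws))))
      product : ∀ as → sum (List.map wordWeight (cartesianProductWith _∷_ as (words n))) ≡
                sum (List.map weight as) * sum (List.map wordWeight (words n))
      product []       = refl
      product (a ∷ as) = begin
        sum (List.map wordWeight (ws List.++ rest))
          ≡⟨ cong sum (map-++ wordWeight ws rest) ⟩
        sum (List.map wordWeight ws List.++ List.map wordWeight rest)
          ≡⟨ sum-++ (List.map wordWeight ws) (List.map wordWeight rest) ⟩
        sum (List.map wordWeight ws) + sum (List.map wordWeight rest)
          ≡⟨ cong₂ _+_ (prefix a (words n)) (product as) ⟩
        weight a * s + sum (List.map weight as) * s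
          ≡⟨ ℕ.*-distribʳ-+ s (weight a) _ ⟨
        sum (List.map weight (a ∷ as)) * s ∎
        where
        ws = List.map (a ∷_) (words n)
        rest = cartesianProductWith _∷_ as (words n)
        s = sum (List.map wordWeight (words n))

    weight-degree : ∀ a → weight a * Q ^ toℕ a ≡ P ^ toℕ a * (Q * Q)
    weight-degree zero             = solve 1 (λ Q → Q :* Q :* con 1 := con 1 :* (Q :* Q)) refl Q
    weight-degree (suc zero)       = solve 2 (λ P Q → P :* Q :* (Q :* con 1) := P :* con 1 :* (Q :* Q)) refl P Q
    weight-degree (suc (suc zero)) = solve 2 (λ P Q → P :* P :* (Q :* (Q :* con 1)) := P :* (P :* con 1) :* (Q :* Q)) refl P Q

    -- This is w(α) = Q^(2n) (P/Q)^(deg α), multiplied by Q^(deg α) to avoid fractions.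
    wordWeight-degree : ∀ (α : Word n) →
                        wordWeight α * Q ^ degree α ≡ P ^ degree α * (Q * Q) ^ n
    wordWeight-degree []      = refl
    wordWeight-degree {suc n} (a ∷ α) = begin
      weight a * wordWeight α * Q ^ (toℕ a + degree α)
        ≡⟨ cong (weight a * wordWeight α *_) (ℕ.^-distribˡ-+-* Q (toℕ a) (degree α)) ⟩
      weight a * wordWeight α * (Q ^ toℕ a * Q ^ degree α)
        ≡⟨ interchange (weight a) (wordWeight α) (Q ^ toℕ a) (Q ^ degree α) ⟩
      weight a * Q ^ toℕ a * (wordWeight α * Q ^ degree α)
        ≡⟨ cong₂ _*_ (weight-degree a) (wordWeight-degree α) ⟩
      P ^ toℕ a * (Q * Q) * (P ^ degree α * (Q * Q) ^ n)
        ≡⟨ interchange (P ^ toℕ a) (Q * Q) (P ^ degree α) ((Q * Q) ^ n) ⟩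
      P ^ toℕ a * P ^ degree α * ((Q * Q) * (Q * Q) ^ n)
        ≡⟨ cong (_* ((Q * Q) ^ suc n)) (ℕ.^-distribˡ-+-* P (toℕ a) (degree α)) ⟨
      P ^ (toℕ a + degree α) * (Q * Q) ^ suc n ∎
      where open ≡-Reasoning

  -- With t = (p/q)³ ≤ 1, a low α has t^(deg α) ≥ (p/q)^(2n); scaling by q^(6n) gives the bound.
  -- Taking t to be a cube keeps t^(2n/3) rational.
  low⇒weight≥ : ∀ {p q} .{{_ : ℕ.NonZero q}} → p ≤ q → ∀ (α : Word n) → Low α →
                (p ^ 2 * q ^ 4) ^ n ≤ wordWeight (p ^ 3) (q ^ 3) α
  low⇒weight≥ {n} {p} {q} p≤q α low = ℕ.*-cancelʳ-≤ _ _ ((q ^ 3) ^ D) {{ℕ.m^n≢0 (q ^ 3) D {{ℕ.m^n≢0 q 3}}}} (begin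
    (p ^ 2 * q ^ 4) ^ n * (q ^ 3) ^ D
      ≡⟨ cong (_* (q ^ 3) ^ D) (^-distribʳ-* (p ^ 2) (q ^ 4) n) ⟩
    (p ^ 2) ^ n * (q ^ 4) ^ n * (q ^ 3) ^ D
      ≡⟨ cong (λ t → t * (q ^ 4) ^ n * (q ^ 3) ^ D) (split p) ⟩
    (p ^ 3) ^ D * p ^ r * (q ^ 4) ^ n * (q ^ 3) ^ D
      ≤⟨ ℕ.*-monoˡ-≤ _ (ℕ.*-monoˡ-≤ ((q ^ 4) ^ n) (ℕ.*-monoʳ-≤ ((p ^ 3) ^ D) (ℕ.^-monoˡ-≤ r p≤q))) ⟩
    (p ^ 3) ^ D * q ^ r * (q ^ 4) ^ n * (q ^ 3) ^ D
      ≡⟨ solve 4 (λ a b c d → a :* b :* c :* d := a :* ((d :* b) :* c)) refl ((p ^ 3) ^ D) (q ^ r) ((q ^ 4) ^ n) ((q ^ 3) ^ D) ⟩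
    (p ^ 3) ^ D * ((q ^ 3) ^ D * q ^ r * (q ^ 4) ^ n)
      ≡⟨ cong (λ t → (p ^ 3) ^ D * (t * (q ^ 4) ^ n)) (split q) ⟨
    (p ^ 3) ^ D * ((q ^ 2) ^ n * (q ^ 4) ^ n)
      ≡⟨ cong ((p ^ 3) ^ D *_) (^-distribʳ-* (q ^ 2) (q ^ 4) n) ⟨
    (p ^ 3) ^ D * (q ^ 2 * q ^ 4) ^ n
      ≡⟨ cong (λ t → (p ^ 3) ^ D * t ^ n) (trans (sym (ℕ.^-distribˡ-+-* q 2 4)) (ℕ.^-distribˡ-+-* q 3 3)) ⟩
    (p ^ 3) ^ D * (q ^ 3 * q ^ 3) ^ n
      ≡⟨ wordWeight-degree (p ^ 3) (q ^ 3) α ⟨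
    wordWeight (p ^ 3) (q ^ 3) α * (q ^ 3) ^ D ∎)
    where
    open ℕ.≤-Reasoning
    D = degree α
    -- The slack in the lowness of α. The inequality above comes from replacing p ^ r by q ^ r.
    r = n * 2 ℕ.∸ D * 3
    split : ∀ t → (t ^ 2) ^ n ≡ (t ^ 3) ^ D * t ^ r
    split t = begin-equality
      (t ^ 2) ^ n           ≡⟨ ℕ.^-*-assoc t 2 n ⟩
      t ^ (2 * n)           ≡⟨ cong (t ^_) (trans (ℕ.*-comm 2 n) (sym (ℕ.m+[n∸m]≡n low))) ⟩
      t ^ (D * 3 + r)       ≡⟨ ℕ.^-distribˡ-+-* t (D * 3) r ⟩
      t ^ (D * 3) * t ^ r   ≡⟨ cong (λ e → t ^ e * t ^ r) (ℕ.*-comm D 3) ⟩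
      t ^ (3 * D) * t ^ r   ≡⟨ cong (_* t ^ r) (ℕ.^-*-assoc t 3 D) ⟨
      (t ^ 3) ^ D * t ^ r   ∎

  #lowWords-≤ : ∀ {p q} .{{_ : ℕ.NonZero q}} → p ≤ q → ∀ n →
                length (lowWords n) * (p ^ 2 * q ^ 4) ^ n ≤ totalWeight (p ^ 3) (q ^ 3) ^ n
  #lowWords-≤ {p} {q} p≤q n = ℕ.≤-trans
    (length-filter-* low? _ (wordWeight (p ^ 3) (q ^ 3)) (low⇒weight≥ p≤q) (words n))
    (ℕ.≤-reflexive (sum-wordWeight (p ^ 3) (q ^ 3) n))

  -- Comparison of exponential growth rates

  -- From t ≥ s + 1 one has (t/s)^n ≥ (1 + 1/s)^n ≥ 1 + n/s; here this is multiplied through by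
  -- s^(n+1).
  bernoulli : ∀ {s t} → s < t → ∀ n → s ^ n * (s + n) ≤ t ^ n * s
  bernoulli {s} {t} s<t zero    = ℕ.≤-reflexive (cong (1 *_) (ℕ.+-identityʳ s))
  bernoulli {s} {t} s<t (suc n) = begin
    s * s ^ n * (s + suc n)               ≤⟨ ℕ.m≤m+n _ (s ^ n * n) ⟩
    s * s ^ n * (s + suc n) + s ^ n * n   ≡⟨ solve 3 (λ s e n → s :* e :* (s :+ (con 1 :+ n)) :+ e :* n := (con 1 :+ s) :* (e :* (s :+ n))) refl s (s ^ n) n ⟩
    suc s * (s ^ n * (s + n))             ≤⟨ ℕ.*-mono-≤ s<t (bernoulli s<t n) ⟩
    t * (t ^ n * s)                       ≡⟨ ℕ.*-assoc t (t ^ n) s ⟨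
    t * t ^ n * s                         ∎
    where open ℕ.≤-Reasoning

  -- Put s = vB. Then f(n) (B/A)^n ≤ 2 (s/(Au))^n ≤ 2s/(s + n) by `bernoulli`, and this is at most
  -- 1/(b + 1) for the given n.
  exponential-gap : ∀ {u v A B} .{{_ : ℕ.NonZero u}} .{{_ : ℕ.NonZero v}} .{{_ : ℕ.NonZero A}} .{{_ : ℕ.NonZero B}} →
    v * B < A * u → ∀ (f : ℕ → ℕ) → (∀ n → f n * u ^ n ≤ 2 * v ^ n) →
    ∀ b n → 2 * (v * B) * suc b ≤ n → f n * B ^ n * b < A ^ n
  exponential-gap {u} {v} {A} {B} gap f f≤ b n large = drop-suc (f n * B ^ n) bound
    where
    open ℕ.≤-Reasoning
    s = v * B
    scaled : f n * B ^ n * suc b * (2 * s * u ^ n) ≤ A ^ n * (2 * s * u ^ n)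
    scaled = begin
      f n * B ^ n * suc b * (2 * s * u ^ n)
        ≡⟨ solve 5 (λ f B b s u → f :* B :* b :* (con 2 :* s :* u) := f :* u :* (B :* (con 2 :* s :* b))) refl (f n) (B ^ n) (suc b) s (u ^ n) ⟩
      f n * u ^ n * (B ^ n * (2 * s * suc b))
        ≤⟨ ℕ.*-mono-≤ (f≤ n) (ℕ.*-monoʳ-≤ (B ^ n) (ℕ.≤-trans large (ℕ.m≤n+m n s))) ⟩
      2 * v ^ n * (B ^ n * (s + n))
        ≡⟨ solve 3 (λ v B t → con 2 :* v :* (B :* t) := con 2 :* (v :* B :* t)) refl (v ^ n) (B ^ n) (s + n) ⟩
      2 * (v ^ n * B ^ n * (s + n))
        ≡⟨ cong (λ e → 2 * (e * (s + n))) (^-distribʳ-* v B n) ⟨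
      2 * (s ^ n * (s + n))
        ≤⟨ ℕ.*-monoʳ-≤ 2 (bernoulli gap n) ⟩
      2 * ((A * u) ^ n * s)
        ≡⟨ cong (λ e → 2 * (e * s)) (^-distribʳ-* A u n) ⟩
      2 * (A ^ n * u ^ n * s)
        ≡⟨ solve 3 (λ A u s → con 2 :* (A :* u :* s) := A :* (con 2 :* s :* u)) refl (A ^ n) (u ^ n) s ⟩
      A ^ n * (2 * s * u ^ n) ∎
    bound : f n * B ^ n * suc b ≤ A ^ n
    bound = ℕ.*-cancelʳ-≤ _ _ (2 * s * u ^ n)
      {{ℕ.m*n≢0 (2 * s) (u ^ n) {{ℕ.m*n≢0 2 s {{_}} {{ℕ.m*n≢0 v B}}}} {{ℕ.m^n≢0 u n}}}} scaled
    -- Proving the bound with b + 1 pays for strictness with b; when x = 0 it comes from A ^ n > 0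
    -- instead.
    drop-suc : ∀ x → x * suc b ≤ A ^ n → x * b < A ^ n
    drop-suc zero    _ = ℕ.m^n>0 A n
    drop-suc (suc x) h = ℕ.<-≤-trans (ℕ.*-monoʳ-< (suc x) (ℕ.n<1+n b)) h

  -- The choice p/q = 5/6 puts t = (5/6)³ close to (√33 - 1)/8, the minimiser of (1 + t + t²) /
  -- t^(2/3). The base becomes 89281/32400, about 2.7556, where the minimum is about 2.7551.
  r₃*32400^n≤2*89281^n : ∀ n → r₃[ℤ/3]^ n * (5 ^ 2 * 6 ^ 4) ^ n ≤ 2 * totalWeight (5 ^ 3) (6 ^ 3) ^ n
  r₃*32400^n≤2*89281^n n = begin
    r₃[ℤ/3]^ n * t                                ≤⟨ ℕ.*-monoˡ-≤ t (r₃≤2N n) ⟩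
    (length (lowWords n) + length (lowWords n)) * t ≡⟨ solve 2 (λ l t → (l :+ l) :* t := con 2 :* (l :* t)) refl (length (lowWords n)) t ⟩
    2 * (length (lowWords n) * t)                 ≤⟨ ℕ.*-monoʳ-≤ 2 (#lowWords-≤ (ℕ.n≤1+n 5) n) ⟩
    2 * totalWeight (5 ^ 3) (6 ^ 3) ^ n           ∎
    where
    open ℕ.≤-Reasoning
    t = (5 ^ 2 * 6 ^ 4) ^ n

-- The rational limit

open import Data.Integer.Base using (+_)
open import Data.Rational.Base using (_*_; _-_; _<_; ∣_∣; 1/_)
open Defs using (_^_)

fromℕ : ℕ → ℚ
fromℕ m = + m / 1

toℚᵘ-fromℕ : ∀ m → toℚᵘ (fromℕ m) ≃ mkℚᵘ (+ m) 0
toℚᵘ-fromℕ m = ℚ.toℚᵘ-fromℚᵘ (mkℚᵘ (+ m) 0)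

fromℕ-* : ∀ m n → fromℕ (m ℕ.* n) ≡ fromℕ m * fromℕ n
fromℕ-* m n = ℚ.toℚᵘ-injective (begin
  toℚᵘ (fromℕ (m ℕ.* n))                ≈⟨ toℚᵘ-fromℕ (m ℕ.* n) ⟩
  mkℚᵘ (+ (m ℕ.* n)) 0                  ≡⟨ cong (λ i → mkℚᵘ i 0) (ℤ.pos-* m n) ⟩
  mkℚᵘ (+ m) 0 ℚᵘ.* mkℚᵘ (+ n) 0        ≈⟨ ℚᵘ.*-cong (toℚᵘ-fromℕ m) (toℚᵘ-fromℕ n) ⟨
  toℚᵘ (fromℕ m) ℚᵘ.* toℚᵘ (fromℕ n)    ≈⟨ ℚ.toℚᵘ-homo-* (fromℕ m) (fromℕ n) ⟨
  toℚᵘ (fromℕ m * fromℕ n)              ∎)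
  where open ℚᵘ.≃-Reasoning

-- A positive rational has numerator at least 1, so ε is at least the reciprocal of its denominator.
fromℕ<ε*fromℕ : ∀ ε → 0ℚ < ε → ∀ x y → x ℕ.* ↧ₙ ε ℕ.< y → fromℕ x < ε * fromℕ y
fromℕ<ε*fromℕ (mkℚ (+ 0)      _ _) (*<* (ℤ.+<+ ())) x y xb<y
fromℕ<ε*fromℕ (mkℚ ℤ.-[1+ _ ] _ _) (*<* ()) x y xb<y
fromℕ<ε*fromℕ ε@(mkℚ +[1+ a ] b _) _ x y xb<y = ℚ.toℚᵘ-cancel-< (begin-strict
  toℚᵘ (fromℕ x)                          ≃⟨ toℚᵘ-fromℕ x ⟩
  mkℚᵘ (+ x) 0                            <⟨ ℚᵘ.*<* cross ⟩
  mkℚᵘ +[1+ a ] b ℚᵘ.* mkℚᵘ (+ y) 0       ≃⟨ ℚᵘ.*-congˡ {toℚᵘ ε} (toℚᵘ-fromℕ y) ⟨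
  toℚᵘ ε ℚᵘ.* toℚᵘ (fromℕ y)              ≃⟨ ℚ.toℚᵘ-homo-* ε (fromℕ y) ⟨
  toℚᵘ (ε * fromℕ y)                      ∎)
  where
  open ℚᵘ.≤-Reasoning
  cross : + x ℤ.* + (suc b ℕ.* 1) ℤ.< +[1+ a ] ℤ.* + y ℤ.* + 1
  cross = subst₂ ℤ._<_
    (trans (cong (λ t → + (x ℕ.* t)) (sym (ℕ.*-identityʳ (suc b)))) (ℤ.pos-* x _))
    (trans (ℤ.pos-* (suc a) y) (sym (ℤ.*-identityʳ _)))
    (ℤ.+<+ (ℕ.<-≤-trans xb<y (ℕ.m≤n*m y (suc a))))

2·756^n*1000^n : ∀ n → 2·756 ^ n * fromℕ (1000 ℕ.^ n) ≡ fromℕ (2756 ℕ.^ n)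
2·756^n*1000^n zero    = refl
2·756^n*1000^n (suc n) = begin
  2·756 * 2·756 ^ n * fromℕ (1000 ℕ.* 1000 ℕ.^ n)
    ≡⟨ cong (2·756 * 2·756 ^ n *_) (fromℕ-* 1000 (1000 ℕ.^ n)) ⟩
  2·756 * 2·756 ^ n * (fromℕ 1000 * fromℕ (1000 ℕ.^ n))
    ≡⟨ interchange 2·756 (2·756 ^ n) (fromℕ 1000) (fromℕ (1000 ℕ.^ n)) ⟩
  2·756 * fromℕ 1000 * (2·756 ^ n * fromℕ (1000 ℕ.^ n))
    -- The closed product `2·756 * fromℕ 1000` evaluates to `fromℕ 2756`.
    ≡⟨ cong (2·756 * fromℕ 1000 *_) (2·756^n*1000^n n) ⟩
  fromℕ 2756 * fromℕ (2756 ℕ.^ n)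
    ≡⟨ fromℕ-* 2756 (2756 ℕ.^ n) ⟨
  fromℕ (2756 ℕ.* 2756 ℕ.^ n) ∎
  where
  open ≡-Reasoning
  open CommutativeSemigroupProperties (CommutativeMonoid.commutativeSemigroup ℚ.*-1-commutativeMonoid) using (interchange)

∣÷∣<ε : ∀ p q ε .{{_ : NonNegative p}} .{{_ : Positive q}} .{{_ : NonZero q}} →
        p < ε * q → ∣ p ÷ q - 0ℚ ∣ < ε
∣÷∣<ε p q ε p<εq = begin-strict
  ∣ p ÷ q - 0ℚ ∣    ≡⟨ cong ∣_∣ (ℚ.+-identityʳ (p ÷ q)) ⟩
  ∣ p ÷ q ∣         ≡⟨ ℚ.0≤p⇒∣p∣≡p (ℚ.nonNegative⁻¹ (p ÷ q) {{p÷q≥0}}) ⟩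
  p * 1/ q          <⟨ ℚ.*-monoˡ-<-pos (1/ q) {{1/q>0}} p<εq ⟩
  ε * q * 1/ q      ≡⟨ ℚ.*-assoc ε q (1/ q) ⟩
  ε * (q * 1/ q)    ≡⟨ cong (ε *_) (ℚ.*-inverseʳ q) ⟩
  ε * 1ℚ            ≡⟨ ℚ.*-identityʳ ε ⟩
  ε                 ∎
  where
  open ℚ.≤-Reasoning
  1/q>0 : Positive (1/ q)
  1/q>0 = ℚ.1/pos⇒pos q
  p÷q≥0 : NonNegative (p ÷ q)
  p÷q≥0 = ℚ.nonNeg*nonNeg⇒nonNeg p (1/ q) {{ℚ.pos⇒nonNeg (1/ q) {{1/q>0}}}}

corollary5 : (λ n → _÷_ (+ (r₃[ℤ/3]^ n) / 1) (2·756 ^ n) {{2·756^n-nonZero n}}) ⟶ 0ℚ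
-- This is the threshold of `exponential-gap` for A/B = 2756/1000, with b the denominator of ε as
-- `fromℕ<ε*fromℕ` requires.
corollary5 ε ε>0 = 2 ℕ.* (v ℕ.* 1000) ℕ.* suc (↧ₙ ε) , λ n large →
  ∣÷∣<ε (fromℕ (r₃[ℤ/3]^ n)) (2·756 ^ n) ε
    {{ℚ.normalize-nonNeg (r₃[ℤ/3]^ n) 1}} {{2·756^n-positive n}} {{2·756^n-nonZero n}}
    (r₃<ε*2·756^n n large)
  where
  u v : ℕ
  u = 5 ℕ.^ 2 ℕ.* 6 ℕ.^ 4
  v = totalWeight (5 ℕ.^ 3) (6 ℕ.^ 3)
  r₃<ε*2·756^n : ∀ n → 2 ℕ.* (v ℕ.* 1000) ℕ.* suc (↧ₙ ε) ℕ.≤ n → fromℕ (r₃[ℤ/3]^ n) < ε * 2·756 ^ n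
  -- Multiplying both sides by 1000 ^ n turns the claim into one about natural numbers.
  r₃<ε*2·756^n n large = ℚ.*-cancelʳ-<-nonNeg (fromℕ (1000 ℕ.^ n)) {{ℚ.normalize-nonNeg (1000 ℕ.^ n) 1}} (begin-strict
    fromℕ (r₃[ℤ/3]^ n) * fromℕ (1000 ℕ.^ n)   ≡⟨ fromℕ-* (r₃[ℤ/3]^ n) (1000 ℕ.^ n) ⟨
    fromℕ (r₃[ℤ/3]^ n ℕ.* 1000 ℕ.^ n)         <⟨ fromℕ<ε*fromℕ ε ε>0 (r₃[ℤ/3]^ n ℕ.* 1000 ℕ.^ n) (2756 ℕ.^ n)
                                                   -- The numerical heart, 89281/32400 < 2756/1000,
                                                   -- is decided by evaluation.
                                                   (exponential-gap {u} {v} {2756} {1000} (from-yes (v ℕ.* 1000 ℕ.<? 2756 ℕ.* u))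
                                                     r₃[ℤ/3]^_ r₃*32400^n≤2*89281^n (↧ₙ ε) n large) ⟩
    ε * fromℕ (2756 ℕ.^ n)                    ≡⟨ cong (ε *_) (2·756^n*1000^n n) ⟨
    ε * (2·756 ^ n * fromℕ (1000 ℕ.^ n))      ≡⟨ ℚ.*-assoc ε (2·756 ^ n) (fromℕ (1000 ℕ.^ n)) ⟨
    ε * 2·756 ^ n * fromℕ (1000 ℕ.^ n)        ∎)
    where open ℚ.≤-Reasoning
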